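{- Let $S$ be a finite unsatisfiable set of propositional clauses, let $U$ be a support set for $S$, and let $Step$ be the stepping sequence for $S$ and $U$. Suppose the procedure $DPLL\text{ - }Rel(S,Step)$ is called at the top level. Then the number of recursive calls to $DPLL\text{ - }Rel(Q,StepR)$ (for the various clause sets $Q$ and stepping remainder sequences $StepR$ that arise) is bounded by $2^k$, where $k$ is the number of literals in the $U$ support neighborhood for $S$, i.e. the number of distinct literals occurring in clauses of the $U$ support neighborhood for $S$.
   Context: A literal is an atom $A$ or its negation $\neg A$; $\neg\neg A$ is identified with $A$. A clause is a finite set of literals, read as their disjunction; the empty clause denotes false. $\equiv$ denotes syntactic identity of literals. **Alternating paths (propositional case).** An alternating path from $C_1$ to $C_n$ in a set $S$ of clauses is a sequence $C_1,p_1,C_2,p_2,\dots,p_{n-1},C_n$ with all $C_i\in S$, where each $p_i=(L_i,M_{i+1})$ with $L_i\in C_i$, $M_{i+1}\in C_{i+1}$, $L_i\equiv\neg M_{i+1}$, and $L_i\not\equiv M_i$ for $1<i<n$. Its length is $n$ (so a single clause is a path of length 1). The relevance distance $d_S(C,D)$ is the length of a shortest alternating path in $S$ from $C$ to $D$, or $\infty$ if there is none. For $T\subseteq S$, $d_S(T,C)=\min\{d_S(D,C):D\in T\}$ and $R_{m,S}(T)=\{C\in S: d_S(T,C)\le m\}$. **Support sets.** A support set for $S$ is a subset $U\subseteq S$ such that every unsatisfiable subset of $S$ has non-empty intersection with $U$. For unsatisfiable $S$, the $U$ support radius for $S$ is the minimal $m$ such that $R_{m,S}(U)$ is unsatisfiable,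 and the $U$ support neighborhood for $S$ is $R_{m,S}(U)$ for this $m$. **Stepping sequences.** For a literal $L$, the relevance distance $d(U,L)$ is the minimal $n$ such that $L$ or its negation appears in a clause of $S$ at relevance distance $n$ from $U$. For a set $T$ of clauses, $\mathcal{L}(T)=\bigcup T$ is the set of literals in clauses of $T$. The stepping sequence for $S$ and $U$ is $(\mathcal{L}_1,\dots,\mathcal{L}_n)$, where $\mathcal{L}_i$ is the set of literals of $S$ at relevance distance $i$ from $U$ and $n$ is the maximum finite relevance distance from $U$ of any literal in $S$. A stepping remainder sequence for $S$ and $U$ is a sequence $(\mathcal{L}'_1,\dots,\mathcal{L}'_n)$ with $\mathcal{L}'_i\subseteq\mathcal{L}_i$ for all $i$. A leading literal of it is an element of $\mathcal{L}'_i$, or the complement of such an element, where $i$ is minimal such that $\mathcal{L}'_i\neq\emptyset$. For $StepR=(\mathcal{L}'_1,\dots,\mathcal{L}'_n)$ and a clause set $T$, $StepR:T$ denotes $(\mathcal{L}'_1\cap\mathcal{L}(T),\dots,\mathcal{L}'_n\cap\mathcal{L}(T))$, and $|StepR|=\sum_i|\mathcal{L}'_i|$. **The procedure.** For a clause set $Q$ and a literal $L$, $Q|L$ is $Q$ with all clauses containing $L$ deleted and $\neg L$ removed from all clauses containing $\neg L$; $Q|\neg L$ is defined in the same way with signs reversed. The recursive procedure $DPLL\text{ - }Rel(Q,StepR)$ is: 1. If the empty clause is in $Q$, return "unsat". 2. Otherwise, if $|StepR|=0$, return "sat". 3. Otherwise choose $L$ to be a leading literal of $StepR$ (any leading literal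 may be chosen). 4. If $DPLL\text{ - }Rel(Q|L,\ StepR:(Q|L))$ returns "unsat", then return the result of $DPLL\text{ - }Rel(Q|\neg L,\ StepR:(Q|\neg L))$. 5. Otherwise return "sat". No unit rules or clause learning are used. -}

module Defs where

open import Data.Bool using (Bool; true; not)
open import Data.Fin using (Fin; toℕ)
open import Data.List using (List; []; _∷_; concat; deduplicate; filter; length; lookup; map; sum)
open import Data.List.Membership.Propositional using (_∈_)
import Data.List.Membership.DecPropositional as DecMembership
import Data.List.Membership.Setoid as SetoidMembership
open import Data.List.Relation.Binary.BagAndSetEquality using ([_]-Equality; set)
import Data.List.Relation.Binary.Subset.Setoid as SetoidSubset
open import Data.List.Relation.Unary.Any using (Any)
open import Data.Maybe using (Maybe; just; nothing)
open import Data.Nat using (ℕ; suc; _+_; _≤_)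
open import Data.Product using (_×_; ∃-syntax)
open import Data.Sum using (_⊎_)
open import Function.Bundles using (_⇔_)
open import Relation.Binary.Bundles using (Setoid)
open import Relation.Binary.Definitions using (DecidableEquality)
open import Relation.Binary.PropositionalEquality using (_≡_; _≢_; refl)
open import Relation.Nullary using (¬_; yes; no)
open import Relation.Nullary.Decidable using (¬?)
open import Relation.Unary using (Pred)
open import Level using (0ℓ)

IsLeast : Pred ℕ 0ℓ → ℕ → Set
IsLeast P n = P n × (∀ m → P m → n ≤ m)

data Literal (Atom : Set) : Set where
  pos neg : Atom → Literal Atom

-- Atoms come with decidable equality, so that the procedure can be executed.
module Propositional {Atom : Set} (_≟_ : DecidableEquality Atom) where

  Lit : Set
  Lit = Literal Atom

  infix 9 ∼_
  infix 4 _≟ᴸ_ _⊨_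

  ∼_ : Lit → Lit
  ∼ pos a = neg a
  ∼ neg a = pos a

  _≟ᴸ_ : DecidableEquality Lit
  pos a ≟ᴸ pos b with a ≟ b
  ... | yes refl = yes refl
  ... | no a≢b   = no λ { refl → a≢b refl }
  pos a ≟ᴸ neg b = no λ ()
  neg a ≟ᴸ pos b = no λ ()
  neg a ≟ᴸ neg b with a ≟ b
  ... | yes refl = yes refl
  ... | no a≢b   = no λ { refl → a≢b refl }

  open DecMembership _≟ᴸ_ using (_∈?_)

  -- Finite sets are represented by lists, in which order and repetition are
  -- irrelevant: clauses are compared by having the same elements (_≈_), and
  -- membership and inclusion of clauses in clause sets are taken up to _≈_.

  Clause : Set
  Clause = List Lit

  ClauseSet : Set
  ClauseSet = List Clause

  clauseSetoid : Setoid 0ℓ 0ℓ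
  clauseSetoid = [ set ]-Equality Lit

  open Setoid clauseSetoid public using (_≈_)
  open SetoidMembership clauseSetoid public using () renaming (_∈_ to _∈ᶜ_; _∉_ to _∉ᶜ_)
  open SetoidSubset clauseSetoid public using () renaming (_⊆_ to _⊆ᶜ_)

  card : List Lit → ℕ
  card Ls = length (deduplicate _≟ᴸ_ Ls)

  𝓛 : ClauseSet → List Lit
  𝓛 T = concat T

  Assignment : Set
  Assignment = Atom → Bool

  value : Assignment → Lit → Bool
  value v (pos a) = v a
  value v (neg a) = not (v a)

  _⊨_ : Assignment → Clause → Set
  v ⊨ C = Any (λ L → value v L ≡ true) C

  Unsatisfiable : Pred Clause 0ℓ → Set
  Unsatisfiable P = ∀ v → ¬ (∀ C → P C → v ⊨ C)

  IsSupportSet : ClauseSet → ClauseSet → Set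
  IsSupportSet S U =
    U ⊆ᶜ S ×
    (∀ T → T ⊆ᶜ S → Unsatisfiable (_∈ᶜ T) → ∃[ C ] (C ∈ᶜ T × C ∈ᶜ U))

  -- PathFrom S e C D n: an alternating path C₁ , p₁ , … , Cₙ with C₁ = C and
  -- Cₙ = D, where e is the literal by which C₁ is entered (nothing if the path
  -- starts at C₁).  The literal used to leave a clause must differ from the
  -- literal used to enter it; the first clause is exempt, and the last clause
  -- is not left.
  data PathFrom (S : ClauseSet) : Maybe Lit → Clause → Clause → ℕ → Set where
    stop : ∀ {e C D} → C ∈ᶜ S → C ≈ D → PathFrom S e C D 1
    step : ∀ {e C C′ D L M n} →
           C ∈ᶜ S → L ∈ C → M ∈ C′ → L ≡ ∼ M → just L ≢ e →
           PathFrom S (just M) C′ D n → PathFrom S e C D (suc n)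

  AlternatingPath : ClauseSet → Clause → Clause → ℕ → Set
  AlternatingPath S = PathFrom S nothing

  -- The relevance distances d are rendered as relations "d = n" with n : ℕ;
  -- distance ∞ means that no n is related.

  Distance : ClauseSet → Clause → Clause → ℕ → Set
  Distance S C D = IsLeast (AlternatingPath S C D)

  DistanceFrom : ClauseSet → ClauseSet → Clause → ℕ → Set
  DistanceFrom S T C = IsLeast λ n → ∃[ D ] (D ∈ᶜ T × Distance S D C n)

  R : ℕ → ClauseSet → ClauseSet → Pred Clause 0ℓ
  R m S T C = C ∈ᶜ S × ∃[ n ] (DistanceFrom S T C n × n ≤ m)

  IsSupportRadius : ClauseSet → ClauseSet → ℕ → Set
  IsSupportRadius S U = IsLeast λ m → Unsatisfiable (R m S U)

  IsSupportNeighborhood : ClauseSet → ClauseSet → ClauseSet → Set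
  IsSupportNeighborhood S U N =
    ∃[ m ] (IsSupportRadius S U m × (∀ C → C ∈ᶜ N ⇔ R m S U C))

  LiteralDistance : ClauseSet → ClauseSet → Lit → ℕ → Set
  LiteralDistance S U L =
    IsLeast λ n → ∃[ C ] (C ∈ᶜ S × (L ∈ C ⊎ ∼ L ∈ C) × DistanceFrom S U C n)

  LiteralSeq : Set
  LiteralSeq = List (List Lit)

  -- The maximum distance is read as 0 if no literal is at finite distance.
  IsMaxLiteralDistance : ClauseSet → ClauseSet → ℕ → Set
  IsMaxLiteralDistance S U n =
    (∀ L i → L ∈ 𝓛 S → LiteralDistance S U L i → i ≤ n) ×
    (n ≡ 0 ⊎ ∃[ L ] (L ∈ 𝓛 S × LiteralDistance S U L n))

  -- Position i, counted from 0, holds the literals at distance i + 1.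
  IsSteppingSequence : ClauseSet → ClauseSet → LiteralSeq → Set
  IsSteppingSequence S U Step =
    IsMaxLiteralDistance S U (length Step) ×
    (∀ (i : Fin (length Step)) L →
       L ∈ lookup Step i ⇔ (L ∈ 𝓛 S × LiteralDistance S U L (suc (toℕ i))))

  data LeadingLiteral (L : Lit) : LiteralSeq → Set where
    here  : ∀ {Ls StepR} → L ∈ Ls ⊎ ∼ L ∈ Ls → LeadingLiteral L (Ls ∷ StepR)
    there : ∀ {StepR} → LeadingLiteral L StepR → LeadingLiteral L ([] ∷ StepR)

  infix 6 _∶_
  infix 7 _∣_

  _∶_ : LiteralSeq → ClauseSet → LiteralSeq
  StepR ∶ T = map (filter (_∈? 𝓛 T)) StepR

  size : LiteralSeq → ℕ
  size StepR = sum (map card StepR)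

  _∣_ : ClauseSet → Lit → ClauseSet
  Q ∣ L = map (filter (λ K → ¬? (K ≟ᴸ ∼ L))) (filter (λ C → ¬? (L ∈? C)) Q)

  data Outcome : Set where
    running sat unsat : Outcome

  -- DPLL-Rel Q StepR o n: some execution of the call on (Q , StepR) has
  -- outcome o and has so far made n calls, including this one.  The relation
  -- is nondeterministic because any leading literal may be chosen.  Outcome
  -- running stands for an execution observed before it returns; bounding n for
  -- these too rules out executions that never return.
  data DPLL-Rel (Q : ClauseSet) (StepR : LiteralSeq) : Outcome → ℕ → Set where
    pending  : DPLL-Rel Q StepR running 1
    conflict : [] ∈ᶜ Q → DPLL-Rel Q StepR unsat 1
    finished : [] ∉ᶜ Q → size StepR ≡ 0 → DPLL-Rel Q StepR sat 1
    one-branch :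
      ∀ {L o m} → [] ∉ᶜ Q → size StepR ≢ 0 → LeadingLiteral L StepR →
      DPLL-Rel (Q ∣ L) (StepR ∶ (Q ∣ L)) o m → o ≢ unsat →
      DPLL-Rel Q StepR o (1 + m)
    two-branches :
      ∀ {L o m n} → [] ∉ᶜ Q → size StepR ≢ 0 → LeadingLiteral L StepR →
      DPLL-Rel (Q ∣ L) (StepR ∶ (Q ∣ L)) unsat m →
      DPLL-Rel (Q ∣ ∼ L) (StepR ∶ (Q ∣ ∼ L)) o n →
      DPLL-Rel Q StepR o (1 + m + n)

{-# OPTIONS --safe #-}

-- Let E be the literals of the levels ≤ m of the stepping sequence, m being the
-- support radius.  Along a run, the clauses of Q built from literals of E stay
-- unsatisfiable, so as long as Q lacks the empty clause E is non-empty and the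
-- leading literal is an atom of the support neighborhood N or its negation.
-- Branching eliminates that atom, so the call tree has depth at most a, the
-- number of atoms of N, and at most 2 ^ (1 + a) ∸ 1 nodes.  Finally 1 + a is at
-- most the number of literals of N: otherwise no atom occurs in N with both
-- signs, so that N, being unsatisfiable, contains the empty clause, and there
-- is just one call.

module Submission where

open import Defs
open import Data.Bool using (true; false; not)
open import Data.Empty using (⊥-elim)
open import Data.Fin using (Fin; zero; suc; toℕ; fromℕ<)
open import Data.Fin.Properties using (toℕ-fromℕ<)
open import Data.List using (List; []; _∷_; _++_; concat; deduplicate; filter; length; lookup; take)
open import Data.List.Properties using (filter-++; filter-notAll; ≡-dec)
open import Data.List.Membership.Propositional using (_∈_; find; lose)
open import Data.List.Membership.Propositional.Properties
  using (∈-++⁺ˡ; ∈-++⁺ʳ; ∈-++⁻; ∈-concat⁺′; ∈-concat⁻′; ∈-filter⁺; ∈-filter⁻; ∈-map⁺; ∈-map⁻; ∈-deduplicate⁺)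
import Data.List.Membership.DecPropositional as DecMembership
open import Data.List.Relation.Unary.All using (All; []; tabulate)
import Data.List.Relation.Unary.All as All
open import Data.List.Relation.Unary.Any using (here; any?)
import Data.List.Relation.Unary.Any as Any
open import Data.Nat using (ℕ; zero; suc; _+_; _≤_; _<_; _^_; z≤n; s≤s)
open import Data.Nat.Induction using (<-rec)
open import Data.Nat.Properties using (≮⇒≥; ≤-trans; <⇒≤; +-identityʳ; +-mono-≤; +-suc; m^n>0; ^-monoʳ-≤)
open import Data.Product using (_×_; _,_; ∃-syntax; proj₁; proj₂)
open import Data.Sum.Base using (_⊎_; inj₁; inj₂)
open import Function.Base using (_∘_)
open import Function.Bundles using (Equivalence; _⇔_)
open import Relation.Binary.Bundles using (Setoid)
open import Relation.Binary.Definitions using (DecidableEquality)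
open import Relation.Binary.PropositionalEquality using (_≡_; _≢_; refl; sym; trans; cong; subst; module ≡-Reasoning)
open import Relation.Nullary using (¬_; yes; no; contradiction)
open import Relation.Nullary.Decidable using (¬?; _×-dec_; does; dec-true; dec-false; decidable-stable)
open import Relation.Unary using (Pred)
open import Level using (0ℓ)

open Equivalence using (to; from)

-- An arbitrary predicate cannot be searched, so minima are obtained only under double negation:
-- strong induction refutes every value if no least one exists.
¬¬-least : ∀ {P : Pred ℕ 0ℓ} {n} → P n → ¬ ¬ (∃[ i ] IsLeast P i)
¬¬-least {P} {n} Pn none = <-rec (¬_ ∘ P) below n Pn
  where
  below : ∀ k → (∀ {i} → i < k → ¬ P i) → ¬ P k
  below k ¬P<k Pk = none (k , Pk , λ i Pi → ≮⇒≥ λ i<k → ¬P<k i<k Pi)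

module _ {A : Set} where

  lookup-∈-take : ∀ {m x} (xss : List (List A)) (i : Fin (length xss)) →
                  toℕ i < m → x ∈ lookup xss i → x ∈ concat (take m xss)
  lookup-∈-take (xs ∷ _)   zero    (s≤s _)   x∈ = ∈-++⁺ˡ x∈
  lookup-∈-take (xs ∷ xss) (suc i) (s≤s i<m) x∈ = ∈-++⁺ʳ xs (lookup-∈-take xss i i<m x∈)

  ∈-take-lookup : ∀ m {x} (xss : List (List A)) → x ∈ concat (take m xss) →
                  ∃[ i ] (toℕ i < m × x ∈ lookup xss i)
  ∈-take-lookup (suc m) (xs ∷ xss) x∈ with ∈-++⁻ xs x∈
  ... | inj₁ x∈xs = zero , s≤s z≤n , x∈xs
  ... | inj₂ x∈′ with i , i<m , x∈i ← ∈-take-lookup m xss x∈′ = suc i , s≤s i<m , x∈i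

module _ {Atom : Set} (_≟_ : DecidableEquality Atom) where
  open Propositional _≟_
  open DecMembership _≟ᴸ_ using (_∈?_)
  private module ≈ = Setoid clauseSetoid

  -- Complements and updated assignments.

  ∼-involutive : ∀ L → ∼ ∼ L ≡ L
  ∼-involutive (pos _) = refl
  ∼-involutive (neg _) = refl

  ∼-irreflexive : ∀ L → ∼ L ≢ L
  ∼-irreflexive (pos _) ()
  ∼-irreflexive (neg _) ()

  infix 4 _∈±_
  _∈±_ : Lit → List Lit → Set
  L ∈± Ls = L ∈ Ls ⊎ ∼ L ∈ Ls

  ∼-∈± : ∀ L {Ls} → L ∈± Ls → ∼ L ∈± Ls
  ∼-∈± L (inj₁ L∈)  = inj₂ (subst (_∈ _) (sym (∼-involutive L)) L∈)
  ∼-∈± L (inj₂ ∼L∈) = inj₁ ∼L∈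

  ∈±-∼ : ∀ L {Ls} → ∼ L ∈± Ls → L ∈± Ls
  ∈±-∼ L (inj₁ ∼L∈)  = inj₂ ∼L∈
  ∈±-∼ L (inj₂ ∼∼L∈) = inj₁ (subst (_∈ _) (∼-involutive L) ∼∼L∈)

  assume : Lit → Assignment → Assignment
  assume L v b with pos b ≟ᴸ L | neg b ≟ᴸ L
  ... | yes _ | _     = true
  ... | no _  | yes _ = false
  ... | no _  | no _  = v b

  value-assumed : ∀ L v → value (assume L v) L ≡ true
  value-assumed (pos a) v with a ≟ a
  ... | yes refl = refl
  ... | no a≢a   = contradiction refl a≢a
  value-assumed (neg a) v with a ≟ a
  ... | yes refl = refl
  ... | no a≢a   = contradiction refl a≢a

  value-other : ∀ {K L} v → K ≢ L → K ≢ ∼ L → value (assume L v) K ≡ value v K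
  value-other {pos b} {L} v K≢L K≢∼L with pos b ≟ᴸ L | neg b ≟ᴸ L
  ... | yes eq | _        = contradiction eq K≢L
  ... | no _   | yes refl = contradiction refl K≢∼L
  ... | no _   | no _     = refl
  value-other {neg b} {L} v K≢L K≢∼L with pos b ≟ᴸ L | neg b ≟ᴸ L
  ... | yes refl | _      = contradiction refl K≢∼L
  ... | no _     | yes eq = contradiction eq K≢L
  ... | no _     | no _   = refl

  ∈⇒∈ᶜ : ∀ {C Q} → C ∈ Q → C ∈ᶜ Q
  ∈⇒∈ᶜ = Any.map ≈.reflexive

  -- Conditioning on a literal, and the initial levels of a literal sequence.

  ∣-∈⁺ : ∀ {Q C L} → C ∈ Q → ¬ L ∈ C → filter (λ K → ¬? (K ≟ᴸ ∼ L)) C ∈ Q ∣ L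
  ∣-∈⁺ {L = L} C∈Q L∉C = ∈-map⁺ _ (∈-filter⁺ (λ C → ¬? (L ∈? C)) C∈Q L∉C)

  -- Clauses with `L` are deleted and `∼ L` is struck from the rest, so the atom disappears in both
  -- signs.
  ∣-eliminates : ∀ Q L {K} → K ∈ 𝓛 (Q ∣ L) → K ≢ L × K ≢ ∼ L
  ∣-eliminates Q L K∈
    with C′ , K∈C′ , C′∈ ← ∈-concat⁻′ (Q ∣ L) K∈
    with C , C∈ , refl ← ∈-map⁻ _ C′∈
    with C∈Q , L∉C ← ∈-filter⁻ (λ C → ¬? (L ∈? C)) {xs = Q} C∈
    with K∈C , K≢∼L ← ∈-filter⁻ (λ K → ¬? (K ≟ᴸ ∼ L)) {xs = C} K∈C′
    = (λ { refl → L∉C K∈C }) , K≢∼L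

  -- Position `i` holds distance `i + 1`, so for the stepping sequence itself these are the literals
  -- at distance at most `m`.
  early : ℕ → LiteralSeq → List Lit
  early m StepR = concat (take m StepR)

  early-∶ : ∀ m StepR T → early m (StepR ∶ T) ≡ filter (_∈? 𝓛 T) (early m StepR)
  early-∶ zero    StepR        T = refl
  early-∶ (suc m) []           T = refl
  early-∶ (suc m) (Ls ∷ StepR) T = begin
    filter P? Ls ++ early m (StepR ∶ T)        ≡⟨ cong (filter P? Ls ++_) (early-∶ m StepR T) ⟩
    filter P? Ls ++ filter P? (early m StepR)  ≡⟨ filter-++ P? Ls (early m StepR) ⟨
    filter P? (Ls ++ early m StepR)            ∎
    where
    open ≡-Reasoning
    P? = _∈? 𝓛 T

  early-∶⁺ : ∀ m StepR T {K} → K ∈ early m StepR → K ∈ 𝓛 T → K ∈ early m (StepR ∶ T)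
  early-∶⁺ m StepR T K∈ K∈T = subst (_ ∈_) (sym (early-∶ m StepR T)) (∈-filter⁺ (_∈? 𝓛 T) K∈ K∈T)

  early-∶⁻ : ∀ m StepR T {K} → K ∈ early m (StepR ∶ T) → K ∈ early m StepR × K ∈ 𝓛 T
  early-∶⁻ m StepR T K∈ = ∈-filter⁻ (_∈? 𝓛 T) (subst (_ ∈_) (early-∶ m StepR T) K∈)

  -- The leading literal comes from the first non-empty level, which is among the first `m` as soon
  -- as one of these is non-empty.
  leading-early : ∀ m {L StepR} → early m StepR ≢ [] → LeadingLiteral L StepR → L ∈± early m StepR
  leading-early zero    E≢[] _                = contradiction refl E≢[]
  leading-early (suc m) E≢[] (here (inj₁ L∈)) = inj₁ (∈-++⁺ˡ L∈)
  leading-early (suc m) E≢[] (here (inj₂ L∈)) = inj₂ (∈-++⁺ˡ L∈)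
  leading-early (suc m) E≢[] (there leading)  = leading-early m E≢[] leading

  -- Plain `∈` replaces `∈ᶜ` because conditioning acts on the listed clauses.
  Over : List Lit → ClauseSet → Pred Clause 0ℓ
  Over E Q C = C ∈ Q × All (_∈ E) C

  -- The only clause over no literals is the empty one, which `Q` lacks, so an empty `E` would leave
  -- nothing to violate.
  unsat⇒early≢[] : ∀ {E Q} → [] ∉ᶜ Q → Unsatisfiable (Over E Q) → E ≢ []
  unsat⇒early≢[] []∉Q ⊭Q refl = ⊭Q (λ _ → true)
    λ { .[] (C∈Q , []) → contradiction (∈⇒∈ᶜ C∈Q) []∉Q }

  -- A model of the conditioned clauses, changed to make `L` true, satisfies the original ones:
  -- those with `L` at once, the others through a surviving literal, whose atom is not that of `L`.
  unsat-∣ : ∀ m {Q StepR} L → Unsatisfiable (Over (early m StepR) Q) →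
            Unsatisfiable (Over (early m (StepR ∶ (Q ∣ L))) (Q ∣ L))
  unsat-∣ m {Q} {StepR} L ⊭Q v v⊨ = ⊭Q (assume L v) extend
    where
    extend : ∀ C → Over (early m StepR) Q C → assume L v ⊨ C
    extend C (C∈Q , C⊆E) with L ∈? C
    ... | yes L∈C = lose L∈C (value-assumed L v)
    ... | no  L∉C = transfer (find (v⊨ C′ (C′∈ , tabulate C′⊆E′)))
      where
      ≢∼L? = λ K → ¬? (K ≟ᴸ ∼ L)
      C′ = filter ≢∼L? C
      C′∈ : C′ ∈ Q ∣ L
      C′∈ = ∣-∈⁺ C∈Q L∉C
      -- Restricting the levels to `Q ∣ L` loses no literal of `C′`, as `C′` is itself a clause of
      -- `Q ∣ L`.
      C′⊆E′ : ∀ {K} → K ∈ C′ → K ∈ early m (StepR ∶ (Q ∣ L))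
      C′⊆E′ K∈C′ = early-∶⁺ m StepR (Q ∣ L)
        (All.lookup C⊆E (proj₁ (∈-filter⁻ ≢∼L? K∈C′))) (∈-concat⁺′ K∈C′ C′∈)
      transfer : ∃[ K ] (K ∈ C′ × value v K ≡ true) → assume L v ⊨ C
      transfer (K , K∈C′ , vK) with K∈C , K≢∼L ← ∈-filter⁻ ≢∼L? {xs = C} K∈C′ =
        lose K∈C (trans (value-other v (λ { refl → L∉C K∈C }) K≢∼L) vK)

  -- Lists covering literals up to sign.

  ≢±? : ∀ L K → _
  ≢±? L K = ¬? (K ≟ᴸ L) ×-dec ¬? (K ≟ᴸ ∼ L)

  remove± : Lit → List Lit → List Lit
  remove± L = filter (≢±? L)

  remove±-< : ∀ L Ls → L ∈± Ls → length (remove± L Ls) < length Ls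
  remove±-< L Ls (inj₁ L∈)  = filter-notAll (≢±? L) Ls (lose L∈ λ ≢± → proj₁ ≢± refl)
  remove±-< L Ls (inj₂ ∼L∈) = filter-notAll (≢±? L) Ls (lose ∼L∈ λ ≢± → proj₂ ≢± refl)

  ∈±-remove± : ∀ {K L Ls} → K ≢ L → K ≢ ∼ L → K ∈± Ls → K ∈± remove± L Ls
  ∈±-remove± {L = L} K≢L K≢∼L (inj₁ K∈) = inj₁ (∈-filter⁺ (≢±? L) K∈ (K≢L , K≢∼L))
  ∈±-remove± {K} {L} K≢L K≢∼L (inj₂ ∼K∈) = inj₂ (∈-filter⁺ (≢±? L) ∼K∈
    ( (λ { refl → K≢∼L (sym (∼-involutive K)) })
    , (λ eq → K≢L (trans (sym (∼-involutive K)) (trans (cong ∼_ eq) (∼-involutive L))))))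

  covers-∶ : ∀ m {Q StepR As} L → (∀ {K} → K ∈ early m StepR → K ∈± As) →
             ∀ {K} → K ∈ early m (StepR ∶ (Q ∣ L)) → K ∈± remove± L As
  covers-∶ m {Q} {StepR} L covers K∈
    with K∈E , K∈Q∣L ← early-∶⁻ m StepR (Q ∣ L) K∈
    with K≢L , K≢∼L ← ∣-eliminates Q L K∈Q∣L
    = ∈±-remove± K≢L K≢∼L (covers K∈E)

  -- Counting calls.

  two-halves : ∀ n {x y} → x ≤ 2 ^ n → y ≤ 2 ^ n → x + y ≤ 2 ^ suc n
  two-halves n x≤ y≤ rewrite +-identityʳ (2 ^ n) = +-mono-≤ x≤ y≤

  2≤2^ : ∀ n → 2 ≤ 2 ^ suc n
  2≤2^ n = two-halves n (m^n>0 2 n) (m^n>0 2 n)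

  leading-covered : ∀ m {As L Q StepR} → (∀ {K} → K ∈ early m StepR → K ∈± As) →
                    Unsatisfiable (Over (early m StepR) Q) → [] ∉ᶜ Q →
                    LeadingLiteral L StepR → L ∈± As
  leading-covered m {As} {L} covers ⊭Q []∉Q leading
    with leading-early m (unsat⇒early≢[] []∉Q ⊭Q) leading
  ... | inj₁ L∈  = covers L∈
  ... | inj₂ ∼L∈ = ∈±-∼ L (covers ∼L∈)

  mutual
    -- Counting one more than the calls makes the bound additive: `1 + (1 + c + d)` is
    -- `(1 + c) + (1 + d)`, and each subtree contributes at most half of the power.
    calls-bound : ∀ m {Q StepR o calls} As →
                  (∀ {K} → K ∈ early m StepR → K ∈± As) →
                  Unsatisfiable (Over (early m StepR) Q) →
                  DPLL-Rel Q StepR o calls → suc calls ≤ 2 ^ suc (length As)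
    calls-bound m As covers ⊭Q pending        = 2≤2^ (length As)
    calls-bound m As covers ⊭Q (conflict _)   = 2≤2^ (length As)
    calls-bound m As covers ⊭Q (finished _ _) = 2≤2^ (length As)
    calls-bound m As covers ⊭Q (one-branch []∉Q _ leading run _) =
      -- The unexplored branch has zero calls, hence contributes `1` to the shifted count.
      two-halves (length As) (m^n>0 2 (length As))
        (branch-bound m As covers ⊭Q (leading-covered m covers ⊭Q []∉Q leading) run)
    calls-bound m As covers ⊭Q (two-branches {L} {m = c} {n = d} []∉Q _ leading run run′) =
      subst (_≤ 2 ^ suc (length As)) (cong suc (+-suc c d))
        (two-halves (length As)
          (branch-bound m As covers ⊭Q L∈±As run)
          (branch-bound m As covers ⊭Q (∼-∈± L L∈±As) run′))
      where L∈±As = leading-covered m covers ⊭Q []∉Q leading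

    -- Removing the atom of `L` shortens `As`, which absorbs the `suc` in the exponent.
    branch-bound : ∀ m {Q StepR L o calls} As →
                   (∀ {K} → K ∈ early m StepR → K ∈± As) →
                   Unsatisfiable (Over (early m StepR) Q) → L ∈± As →
                   DPLL-Rel (Q ∣ L) (StepR ∶ (Q ∣ L)) o calls → suc calls ≤ 2 ^ length As
    branch-bound m {Q} {L = L} As covers ⊭Q L∈±As run = ≤-trans
      (calls-bound m (remove± L As) (covers-∶ m {Q} L covers) (unsat-∣ m L ⊭Q) run)
      (^-monoʳ-≤ 2 (remove±-< L As L∈±As))

  conflict-calls : ∀ {Q StepR o calls} → [] ∈ᶜ Q → DPLL-Rel Q StepR o calls → calls ≡ 1
  conflict-calls []∈Q pending                       = refl
  conflict-calls []∈Q (conflict _)                  = refl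
  conflict-calls []∈Q (finished _ _)                = refl
  conflict-calls []∈Q (one-branch []∉Q _ _ _ _)     = contradiction []∈Q []∉Q
  conflict-calls []∈Q (two-branches []∉Q _ _ _ _)   = contradiction []∈Q []∉Q

  -- The support neighborhood compared with the initial levels.

  ∈ᶜ-𝓛 : ∀ {K C Q} → K ∈ C → C ∈ᶜ Q → K ∈ 𝓛 Q
  ∈ᶜ-𝓛 K∈C C∈Q with C′ , C′∈Q , C≈C′ ← find C∈Q = ∈-concat⁺′ (to C≈C′ K∈C) C′∈Q

  ⊨-resp-≈ : ∀ {v C D} → C ≈ D → v ⊨ C → v ⊨ D
  ⊨-resp-≈ C≈D v⊨C with K , K∈C , vK ← find v⊨C = lose (to C≈D K∈C) vK

  -- Without complementary literals, making exactly the atoms that occur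
  -- positively true satisfies every non-empty clause.
  complementary-pair : ∀ N → Unsatisfiable (_∈ᶜ N) →
                       [] ∈ N ⊎ ∃[ K ] (K ∈ 𝓛 N × ∼ K ∈ 𝓛 N)
  complementary-pair N ⊭N with any? (λ K → ∼ K ∈? 𝓛 N) (𝓛 N) | any? (≡-dec _≟ᴸ_ []) N
  ... | yes pair | _        = inj₂ (find pair)
  ... | no _     | yes []∈N = inj₁ []∈N
  ... | no ¬pair | no []∉N  = ⊥-elim (⊭N v satisfied)
    where
    v : Assignment
    v a = does (pos a ∈? 𝓛 N)
    value-v : ∀ {K} → K ∈ 𝓛 N → value v K ≡ true
    value-v {pos a} K∈ = dec-true (pos a ∈? 𝓛 N) K∈
    value-v {neg a} K∈ = cong not (dec-false (pos a ∈? 𝓛 N) λ pos∈ → ¬pair (lose pos∈ K∈))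
    satisfied : ∀ C → C ∈ᶜ N → v ⊨ C
    satisfied C C∈N with find C∈N
    ... | []    , C′∈N , _    = contradiction C′∈N []∉N
    ... | K ∷ _ , C′∈N , C≈C′ =
      lose (from C≈C′ (here refl)) (value-v (∈-concat⁺′ (here refl) C′∈N))

  PathFrom-length : ∀ {S e C D n} → PathFrom S e C D n → 1 ≤ n
  PathFrom-length (stop _ _)         = s≤s z≤n
  PathFrom-length (step _ _ _ _ _ _) = s≤s z≤n

  LiteralDistance-positive : ∀ {S U L n} → LiteralDistance S U L n → 1 ≤ n
  LiteralDistance-positive ((_ , _ , _ , (_ , _ , path , _) , _) , _) = PathFrom-length path

  module _ {S U N Step} (stepping : IsSteppingSequence S U Step) {m}
           (N⇔R : ∀ C → C ∈ᶜ N ⇔ R m S U C) where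

    -- Literal distance admits the complement in place of the literal, hence membership only up to
    -- sign.
    early⇒𝓛N : ∀ {L} → L ∈ early m Step → L ∈± 𝓛 N
    early⇒𝓛N {L} L∈
      with i , i<m , L∈i ← ∈-take-lookup m Step L∈
      with _ , (C , C∈S , L∈±C , dist) , _ ← to (proj₂ stepping i L) L∈i
      -- `i<m` unfolds to `suc (toℕ i) ≤ m`, the bound on the distance of `C`.
      with C∈N ← from (N⇔R C) (C∈S , _ , dist , i<m)
      with L∈±C
    ... | inj₁ L∈C  = inj₁ (∈ᶜ-𝓛 L∈C C∈N)
    ... | inj₂ ∼L∈C = inj₂ (∈ᶜ-𝓛 ∼L∈C C∈N)

    -- Distances exist only up to double negation, which the decidability of
    -- list membership removes.
    𝓛N⇒early : ∀ {C K} → C ∈ᶜ N → K ∈ C → K ∈ early m Step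
    𝓛N⇒early {C} {K} C∈N K∈C with C∈S , n , dist , n≤m ← to (N⇔R C) C∈N =
      decidable-stable (K ∈? early m Step) λ K∉ →
        ¬¬-least (C , C∈S , inj₁ K∈C , dist) λ (i , K-dist) →
          K∉ (at-level K-dist (≤-trans (proj₂ K-dist n (C , C∈S , inj₁ K∈C , dist)) n≤m))
      where
      K∈S : K ∈ 𝓛 S
      K∈S = ∈ᶜ-𝓛 K∈C (proj₁ (to (N⇔R C) C∈N))
      at-level : ∀ {i} → LiteralDistance S U K i → i ≤ m → K ∈ early m Step
      at-level {zero}  K-dist _   = contradiction (LiteralDistance-positive K-dist) λ ()
      at-level {suc i} K-dist i<m = lookup-∈-take Step j
        (subst (_< m) (sym j≡i) i<m)
        (from (proj₂ stepping j K) (K∈S , subst (LiteralDistance S U K ∘ suc) (sym j≡i) K-dist))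
        where
        i<n : i < length Step
        i<n = proj₁ (proj₁ stepping) K (suc i) K∈S K-dist
        j = fromℕ< i<n
        j≡i : toℕ j ≡ i
        j≡i = toℕ-fromℕ< i<n

    -- By `𝓛N⇒early` each neighborhood clause uses only early literals; its listed copy in `S` then
    -- falls under `Over`.
    neighborhood-unsat : Unsatisfiable (R m S U) → Unsatisfiable (Over (early m Step) S)
    neighborhood-unsat ⊭R v v⊨ = ⊭R v λ C C∈R →
      let C∈N = from (N⇔R C) C∈R
          C′ , C′∈S , C≈C′ = find (proj₁ C∈R)
      in ⊨-resp-≈ (≈.sym C≈C′) (v⊨ C′ (C′∈S , tabulate λ K∈C′ → 𝓛N⇒early C∈N (from C≈C′ K∈C′)))

    calls≤2^literals : Unsatisfiable (R m S U) → ∀ {o calls} → DPLL-Rel S Step o calls →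
                       calls ≤ 2 ^ card (𝓛 N)
    calls≤2^literals ⊭R run
      with complementary-pair N (λ v v⊨ → ⊭R v λ C C∈R → v⊨ C (from (N⇔R C) C∈R))
    -- An empty clause of `N` also lies in `S`, so the run is a single call.
    ... | inj₁ []∈N rewrite conflict-calls (proj₁ (to (N⇔R []) (∈⇒∈ᶜ []∈N))) run =
      m^n>0 2 (card (𝓛 N))
    ... | inj₂ (K , K∈ , ∼K∈) = <⇒≤ (≤-trans
      (calls-bound m As covers (neighborhood-unsat ⊭R) run)
      (^-monoʳ-≤ 2 (filter-notAll ≢K? Ls (lose (∈-deduplicate⁺ _≟ᴸ_ K∈) λ K≢K → K≢K refl))))
      where
      Ls = deduplicate _≟ᴸ_ (𝓛 N)
      ≢K? = λ L → ¬? (L ≟ᴸ K)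
      -- `∼ K` covers `K`, so dropping `K` alone leaves a cover shorter than `card (𝓛 N)`, which
      -- makes up for the exponent `suc (length As)`.
      As = filter ≢K? Ls
      𝓛N⇒As : ∀ {L} → L ∈ 𝓛 N → L ∈± As
      𝓛N⇒As {L} L∈ with L ≟ᴸ K
      ... | no L≢K   = inj₁ (∈-filter⁺ ≢K? (∈-deduplicate⁺ _≟ᴸ_ L∈) L≢K)
      ... | yes refl = inj₂ (∈-filter⁺ ≢K? (∈-deduplicate⁺ _≟ᴸ_ ∼K∈) (∼-irreflexive K))
      covers : ∀ {L} → L ∈ early m Step → L ∈± As
      covers {L} L∈ with early⇒𝓛N L∈
      ... | inj₁ L∈N  = 𝓛N⇒As L∈N
      ... | inj₂ ∼L∈N = ∈±-∼ L (𝓛N⇒As ∼L∈N)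

theorem9 : ∀ {Atom : Set} (_≟_ : DecidableEquality Atom) → let open Propositional _≟_ in
    ∀ (S U : ClauseSet) → Unsatisfiable (λ C → C ∈ᶜ S) → IsSupportSet S U →
    ∀ (Step : LiteralSeq) → IsSteppingSequence S U Step →
    ∀ (N : ClauseSet) → IsSupportNeighborhood S U N →
    ∀ {o : Outcome} {calls : ℕ} → DPLL-Rel S Step o calls →
    calls ≤ 2 ^ card (𝓛 N)
theorem9 _≟_ S U _ _ Step stepping N (m , (⊭R , _) , N⇔R) =
  calls≤2^literals _≟_ stepping N⇔R ⊭R
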